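{- If $G$ is a connected graph that is claw-$o_{ -1}$-heavy and $Z_1$-free, then $G$ is traceable.
   Context: All graphs are finite and simple; $d(v)$ is the degree of $v$ in $G$. A claw is $K_{1,3}$. $G$ (on $n$ vertices) is claw-$o_{ -1}$-heavy if every induced subgraph of $G$ isomorphic to $K_{1,3}$ contains two nonadjacent vertices whose degree sum in $G$ is at least $n-1$. $Z_1$ is the graph obtained from a triangle by attaching one pendant vertex to one of its vertices; $G$ is $Z_1$-free if it has no induced subgraph isomorphic to $Z_1$. Traceable means having a path through all vertices. -}

module Defs where

open import Data.Nat using (ℕ; _+_; _∸_; _≥_)
open import Data.Fin using (Fin)
open import Data.Bool using (Bool; true; false)
open import Data.List using (List; []; _∷_; filter; length; allFin)
open import Data.List.Relation.Unary.Unique.Propositional using (Unique)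
open import Data.List.Membership.Propositional using (_∈_)
open import Data.Product using (Σ; _×_; ∃-syntax)
open import Data.Sum using (_⊎_)
open import Relation.Binary.PropositionalEquality using (_≡_; _≢_)
open import Relation.Nullary using (¬_)
open import Relation.Nullary.Decidable using (does)
open import Data.Bool.Properties using (T?)

record Graph (n : ℕ) : Set where
  field
    adj     : Fin n → Fin n → Bool
    sym     : ∀ u v → adj u v ≡ adj v u
    irrefl  : ∀ v → adj v v ≡ false

open Graph public

Adj : ∀ {n} → Graph n → Fin n → Fin n → Set
Adj G u v = adj G u v ≡ true

deg : ∀ {n} → Graph n → Fin n → ℕ
deg {n} G v = length (filter (λ u → T? (adj G v u)) (allFin n))

data IsWalk {n} (G : Graph n) : List (Fin n) → Set where
  nil  : IsWalk G []
  one  : ∀ v → IsWalk G (v ∷ [])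
  cons : ∀ {u v vs} → Adj G u v → IsWalk G (v ∷ vs) → IsWalk G (u ∷ v ∷ vs)

data PathFrom {n} (G : Graph n) : Fin n → Fin n → Set where
  here : ∀ v → PathFrom G v v
  step : ∀ {u w v} → Adj G u w → PathFrom G w v → PathFrom G u v

Connected : ∀ {n} → Graph n → Set
Connected G = ∀ u v → PathFrom G u v

IsClaw : ∀ {n} → Graph n → Fin n → Fin n → Fin n → Fin n → Set
IsClaw G c a b d =
  Adj G c a × Adj G c b × Adj G c d ×
  ¬ Adj G a b × ¬ Adj G a d × ¬ Adj G b d ×
  a ≢ b × a ≢ d × b ≢ d

-- every induced claw contains two nonadjacent vertices with degree sum ≥ n - 1
-- (the nonadjacent pairs of a claw are exactly the pairs of leaves)
ClawO-1Heavy : ∀ {n} → Graph n → Set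
ClawO-1Heavy {n} G = ∀ c a b d → IsClaw G c a b d →
  (deg G a + deg G b ≥ n ∸ 1) ⊎ (deg G a + deg G d ≥ n ∸ 1) ⊎ (deg G b + deg G d ≥ n ∸ 1)

IsZ1 : ∀ {n} → Graph n → Fin n → Fin n → Fin n → Fin n → Set
IsZ1 G x y z w =
  Adj G x y × Adj G x z × Adj G y z × Adj G x w × ¬ Adj G y w × ¬ Adj G z w ×
  w ≢ y × w ≢ z

Z1Free : ∀ {n} → Graph n → Set
Z1Free G = ∀ x y z w → ¬ IsZ1 G x y z w

Traceable : ∀ {n} → Graph n → Set
Traceable {n} G = ∃[ P ] (IsWalk G P × Unique P × (∀ v → v ∈ P))

-- Call u, v heavy if d(u) + d(v) ≥ n - 1, and v high if 2 d(v) ≥ n - 1. Any two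
-- high vertices are heavy, and a heavy pair contains a high vertex. As in Ore's
-- theorem, a longest path in the graph with all heavy pairs added can be
-- rerouted, on the same vertices, to a path of G.
--
-- If G has a triangle then, being connected and Z₁-free, it is complete
-- multipartite, and every non-adjacent pair is heavy.
--
-- Otherwise G is triangle-free, so that any three neighbours of a vertex
-- contain a heavy pair. Let the path S run from s to t and miss w, where w is
-- adjacent to x₀ in S, and let a, b be the neighbours of x₀ along S. By
-- maximality {a, b} is heavy while w, s, t are pairwise not heavy, and no high
-- vertex is adjacent to two of w, s, t. Adjacent high vertices have disjoint
-- neighbourhoods that miss one of w, s, t, so high vertices have 2 d = n - 1
-- exactly, heavy pairs consist of two high vertices, and every high vertex is
-- adjacent to one of w, s, t. Then a, b and a high neighbour of a other than x₀
-- are all adjacent to s or t, but s and t have only one neighbour each.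
module Submission where

import Algebra.Solver.CommutativeMonoid as CommutativeMonoidSolver
import Data.Bool as Bool
open import Data.Bool using (Bool; true; false; if_then_else_)
open import Data.Bool.Properties using (T?; T-≡; ¬-not)
open import Data.Empty using (⊥; ⊥-elim)
open import Data.Fin using (Fin; zero; suc)
import Data.Fin.Properties as Fin
open import Data.List using (List; []; _∷_; [_]; _++_; length; filter; allFin)
open import Data.List.Properties using (length-++; length-tabulate; filter-++; filter-≐; ++-assoc)
open import Data.List.Membership.Propositional using (_∈_; _∉_)
open import Data.List.Membership.Propositional.Properties
  using (∈-++⁺ˡ; ∈-++⁺ʳ; ∈-++⁻; ∈-filter⁺; ∈-filter⁻; ∈-allFin)
open import Data.List.Membership.Propositional.Properties.WithK using (unique∧set⇒bag)
import Data.List.Membership.Setoid.Properties as Mem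
open import Data.List.Relation.Binary.BagAndSetEquality using (∼bag⇒↭)
open import Data.List.Relation.Binary.Permutation.Propositional
  using (_↭_; ↭⇒↭ₛ; ↭-refl; ↭-sym; ↭-trans; ↭-reflexive; prep)
open import Data.List.Relation.Binary.Permutation.Propositional.Properties
  using (↭-length; filter-↭; ∈-resp-↭; ++⁺; ++⁺ˡ; ++-comm; ++-commutativeMonoid)
import Data.List.Relation.Binary.Permutation.Setoid.Properties as Perm
open import Data.List.Relation.Unary.All using (All; []; _∷_)
open import Data.List.Relation.Unary.All.Properties using (¬Any⇒All¬)
open import Data.List.Relation.Unary.AllPairs using ([]; _∷_)
open import Data.List.Relation.Unary.Any using (here; there; index)
open import Data.List.Relation.Unary.Unique.Propositional using (Unique)
open import Data.List.Relation.Unary.Unique.Propositional.Properties as Unique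
  using (allFin⁺; Unique[x∷xs]⇒x∉xs)
open import Data.Nat using (ℕ; zero; suc; _+_; _∸_; _≤_; _<_; z≤n; s≤s)
open import Data.Nat.Properties
open import Data.Nat.Solver using (module +-*-Solver)
open import Data.Product using (_×_; _,_; ∃-syntax; proj₁; proj₂)
open import Data.Sum using (_⊎_; inj₁; inj₂)
open import Function using (_∘_; mk⇔; Equivalence)
open import Relation.Binary.PropositionalEquality
  using (_≡_; _≢_; refl; sym; trans; cong; cong₂; subst; setoid; ≢-sym)
open import Relation.Binary.Definitions using (tri<; tri≈; tri>)
open import Relation.Nullary using (¬_; Dec; yes; no)
open import Relation.Nullary.Decidable using (map′; _×-dec_; ¬?)

open import Defs hiding (sym)

private
  variable
    n : ℕ

-- Lists of vertices without repetition

Unique-resp-↭ : ∀ {L M : List (Fin n)} → L ↭ M → Unique L → Unique M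
Unique-resp-↭ L↭M = Perm.Unique-resp-↭ (setoid _) (↭⇒↭ₛ L↭M)

∉⇒Unique : ∀ {v} {L : List (Fin n)} → v ∉ L → Unique L → Unique (v ∷ L)
∉⇒Unique v∉L uL = ¬Any⇒All¬ _ v∉L ∷ uL

Unique⇒disjoint : ∀ {x y} (L : List (Fin n)) {M} → Unique (L ++ M) → x ∈ L → y ∈ M → x ≢ y
Unique⇒disjoint (_ ∷ L) u@(_ ∷ _) (here refl) y∈M refl =
  Unique[x∷xs]⇒x∉xs u (∈-++⁺ʳ L y∈M)
Unique⇒disjoint (_ ∷ L) (_ ∷ u) (there x∈L) y∈M = Unique⇒disjoint L u x∈L y∈M

Unique-++⁻ˡ : ∀ (L : List (Fin n)) {M} → Unique (L ++ M) → Unique L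
Unique-++⁻ˡ []      u       = []
Unique-++⁻ˡ (x ∷ L) (p ∷ u) =
  ∉⇒Unique (λ x∈L → Unique[x∷xs]⇒x∉xs (p ∷ u) (∈-++⁺ˡ x∈L)) (Unique-++⁻ˡ L u)

Unique-++⁻ʳ : ∀ (L : List (Fin n)) {M} → Unique (L ++ M) → Unique M
Unique-++⁻ʳ []      u       = u
Unique-++⁻ʳ (_ ∷ L) (_ ∷ u) = Unique-++⁻ʳ L u

cover⇒≤length : ∀ (L : List (Fin n)) → (∀ v → v ∈ L) → n ≤ length L
cover⇒≤length L all = Fin.injective⇒≤ {f = λ v → index (all v)}
  (λ {u} {v} → Mem.index-injective (setoid _) (all u) (all v))

module _ {n : ℕ} where
  open import Data.List.Membership.DecPropositional (Fin._≟_ {n}) public using (_∈?_)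
  open import Data.List.Relation.Unary.Unique.DecPropositional (Fin._≟_ {n}) public using (unique?)

<length⇒∃∉ : ∀ (L : List (Fin n)) → length L < n → ∃[ v ] v ∉ L
<length⇒∃∉ L L<n = Fin.¬∀⟶∃¬ _ (_∈ L) (_∈? L)
  (λ all → <⇒≱ L<n (cover⇒≤length L all))

Unique⇒allFin↭ : ∀ {L : List (Fin n)} → Unique L → (∀ v → v ∈ L) → allFin n ↭ L
Unique⇒allFin↭ uL all = ∼bag⇒↭ (unique∧set⇒bag (allFin⁺ _) uL
  (mk⇔ (λ _ → all _) (λ _ → ∈-allFin _)))

outside : List (Fin n) → List (Fin n)
outside L = filter (λ v → ¬? (v ∈? L)) (allFin _)

∈-outside⁻ : ∀ (L : List (Fin n)) {v} → v ∈ outside L → v ∉ L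
∈-outside⁻ L v∈ = proj₂ (∈-filter⁻ _ {xs = allFin _} v∈)

allFin↭ : ∀ {L : List (Fin n)} → Unique L → allFin n ↭ L ++ outside L
allFin↭ {L = L} uL = Unique⇒allFin↭
  (Unique.++⁺ uL (Unique.filter⁺ _ (allFin⁺ _)) (λ (v∈L , v∈o) → ∈-outside⁻ L v∈o v∈L))
  cover
  where
  cover : ∀ v → v ∈ L ++ outside L
  cover v with v ∈? L
  ... | yes v∈L = ∈-++⁺ˡ v∈L
  ... | no  v∉L = ∈-++⁺ʳ L (∈-filter⁺ _ (∈-allFin v) v∉L)

Unique⇒length≤ : ∀ {L : List (Fin n)} → Unique L → length L ≤ n
Unique⇒length≤ {n} {L} uL = begin
  length L                        ≤⟨ m≤m+n _ _ ⟩
  length L + length (outside L)   ≡⟨ length-++ L ⟨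
  length (L ++ outside L)         ≡⟨ ↭-length (allFin↭ uL) ⟨
  length (allFin n)               ≡⟨ length-tabulate (λ i → i) ⟩
  n                               ∎
  where open ≤-Reasoning

Unique∧full⇒cover : ∀ {L : List (Fin n)} → Unique L → length L ≡ n → ∀ v → v ∈ L
Unique∧full⇒cover {L = L} uL full v with v ∈? L
... | yes v∈L = v∈L
... | no  v∉L = ⊥-elim (1+n≰n
  (subst (λ k → suc (length L) ≤ k) (sym full) (Unique⇒length≤ (∉⇒Unique v∉L uL))))

-- Exhaustive search for a Hamiltonian path

∃list? : ∀ k {P : List (Fin n) → Set} → (∀ L → Dec (P L)) → Dec (∃[ L ] (length L ≡ k × P L))
∃list? zero P? = map′ (λ p → [] , refl , p) (λ { ([] , _ , p) → p }) (P? [])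
∃list? (suc k) P? = map′
  (λ (x , L , eq , p) → x ∷ L , cong suc eq , p)
  (λ { (x ∷ L , eq , p) → x , L , suc-injective eq , p })
  (Fin.any? λ x → ∃list? k (λ L → P? (x ∷ L)))

module _ (G : Graph n) where

  Adj? : ∀ u v → Dec (Adj G u v)
  Adj? u v = adj G u v Bool.≟ true

  walk? : ∀ L → Dec (IsWalk G L)
  walk? []          = yes nil
  walk? (v ∷ [])    = yes (one v)
  walk? (u ∷ v ∷ L) = map′ (λ (e , p) → cons e p) (λ { (cons e p) → e , p })
    (Adj? u v ×-dec walk? (v ∷ L))

  HamiltonianPath : Set
  HamiltonianPath = ∃[ P ] (length P ≡ n × IsWalk G P × Unique P)

  -- Fixing the length makes the search finite. Decidability is what allows a Hamiltonian path to be
  -- obtained by refuting its absence.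
  hamiltonianPath? : Dec HamiltonianPath
  hamiltonianPath? = ∃list? n (λ P → walk? P ×-dec unique? P)

  HamiltonianPath⇒Traceable : HamiltonianPath → Traceable G
  HamiltonianPath⇒Traceable (P , full , walk , uP) = P , walk , uP , Unique∧full⇒cover uP full

-- Paths with heavy steps: joining, reversing, splitting

module Paths (G : Graph n) where

  V : Set
  V = Fin n

  open CommutativeMonoidSolver (++-commutativeMonoid {A = V}) public
    using (_⊜_; _⊕_) renaming (solve to ↭-solve)

  Heavy : V → V → Set
  Heavy u v = n ∸ 1 ≤ deg G u + deg G v

  Adj-sym : ∀ {u v} → Adj G u v → Adj G v u
  Adj-sym {u} {v} e = trans (Graph.sym G v u) e

  Adj⇒≢ : ∀ {u v} → Adj G u v → u ≢ v
  Adj⇒≢ {u} e refl with trans (sym e) (irrefl G u)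
  ... | ()

  Heavy-sym : ∀ {u v} → Heavy u v → Heavy v u
  Heavy-sym {u} {v} h = ≤-trans h (≤-reflexive (+-comm (deg G u) (deg G v)))

  -- The index bounds the number of heavy steps; index 0 gives paths of G.
  data Step : ℕ → V → V → Set where
    edge  : ∀ {k u v} → Adj G u v → Step k u v
    heavy : ∀ {k u v} → Heavy u v → Step (suc k) u v

  data Seg : ℕ → V → V → List V → Set where
    stop   : ∀ {k} a → Seg k a a (a ∷ [])
    edge∷  : ∀ {k a b c L} → Adj G a b → Seg k b c L → Seg k a c (a ∷ L)
    heavy∷ : ∀ {k a b c L} → Heavy a b → Seg k b c L → Seg (suc k) a c (a ∷ L)

  -- The list of vertices is only recorded up to permutation, so that
  -- reversing a path does not change its type except for the ends.
  record Path (k : ℕ) (s t : V) (L : List V) : Set where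
    constructor path
    field
      {route} : List V
      seg     : Seg k s t route
      perm    : route ↭ L

  Step-sym : ∀ {k u v} → Step k u v → Step k v u
  Step-sym (edge e)   = edge (Adj-sym e)
  Step-sym (heavy {u = u} {v} h) = heavy (Heavy-sym {u} {v} h)

  Step₀ : ∀ {u v} → Step 0 u v → Adj G u v
  Step₀ (edge e) = e

  seg-weaken : ∀ {k l a b L} → k ≤ l → Seg k a b L → Seg l a b L
  seg-weaken k≤l       (stop a)        = stop a
  seg-weaken k≤l       (edge∷ e p)   = edge∷ e (seg-weaken k≤l p)
  seg-weaken (s≤s k≤l) (heavy∷ h p) = heavy∷ h (seg-weaken k≤l p)

  seg-cons : ∀ {l j a b c L} → Step l a b → Seg j b c L → Seg (l + j) a c (a ∷ L)
  seg-cons {l}     (edge e)   p = edge∷ e (seg-weaken (m≤n+m _ l) p)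
  seg-cons {suc l} (heavy h) p = heavy∷ h (seg-weaken (m≤n+m _ l) p)

  seg-join : ∀ {i l j a b c d L M} →
             Seg i a b L → Step l b c → Seg j c d M → Seg (i + (l + j)) a d (L ++ M)
  seg-join {i} (stop a)        e q = seg-weaken (m≤n+m _ i) (seg-cons e q)
  seg-join     (edge∷ f p)   e q = edge∷ f (seg-join p e q)
  seg-join     (heavy∷ h p) e q = heavy∷ h (seg-join p e q)

  seg-snoc-adj : ∀ {k a b c L} → Seg k a b L → Adj G b c → Seg k a c (L ++ [ c ])
  seg-snoc-adj (stop a)        e = edge∷ e (stop _)
  seg-snoc-adj (edge∷ f p)   e = edge∷ f (seg-snoc-adj p e)
  seg-snoc-adj (heavy∷ h p) e = heavy∷ h (seg-snoc-adj p e)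

  seg-snoc-heavy : ∀ {k a b c L} → Seg k a b L → Heavy b c → Seg (suc k) a c (L ++ [ c ])
  seg-snoc-heavy (stop a)        e = heavy∷ e (stop _)
  seg-snoc-heavy (edge∷ f p)   e = edge∷ f (seg-snoc-heavy p e)
  seg-snoc-heavy (heavy∷ h p) e = heavy∷ h (seg-snoc-heavy p e)

  infixl 4 _▷_
  _▷_ : ∀ {k s t L M} → Path k s t L → L ↭ M → Path k s t M
  path p L↭ ▷ L↭M = path p (↭-trans L↭ L↭M)

  ⟨_⟩ : ∀ v → Path 0 v v [ v ]
  ⟨ v ⟩ = path (stop v) ↭-refl

  infixr 5 _—⟨_⟩_
  _—⟨_⟩_ : ∀ {i l j a b c d L M} →
           Path i a b L → Step l b c → Path j c d M → Path (i + (l + j)) a d (L ++ M)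
  path p L↭ —⟨ e ⟩ path q M↭ = path (seg-join p e q) (++⁺ L↭ M↭)

  weaken : ∀ {k l s t L} → k ≤ l → Path k s t L → Path l s t L
  weaken k≤l (path p L↭) = path (seg-weaken k≤l p) L↭

  seg-rev : ∀ {k s t L} → Seg k s t L → Path k t s L
  seg-rev (stop a) = path (stop a) ↭-refl
  seg-rev (edge∷ {a = a} e p) with seg-rev p
  ... | path q L↭ = path (seg-snoc-adj q (Adj-sym e)) (↭-trans (++-comm _ [ a ]) (prep a L↭))
  seg-rev (heavy∷ {a = a} {b} h p) with seg-rev p
  ... | path q L↭ = path (seg-snoc-heavy q (Heavy-sym {a} {b} h))
    (↭-trans (++-comm _ [ a ]) (prep a L↭))

  rev : ∀ {k s t L} → Path k s t L → Path k t s L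
  rev (path p L↭) = seg-rev p ▷ L↭

  seg-start : ∀ {k s t L} → Seg k s t L → s ∈ L
  seg-start (stop a)        = here refl
  seg-start (edge∷ e p)   = here refl
  seg-start (heavy∷ h p) = here refl

  start∈ : ∀ {k s t L} → Path k s t L → s ∈ L
  start∈ (path p L↭) = ∈-resp-↭ L↭ (seg-start p)

  end∈ : ∀ {k s t L} → Path k s t L → t ∈ L
  end∈ p = start∈ (rev p)

  -- Both pieces simply inherit the bound `k`: in the uses below it is either 0, or immaterial
  -- because lengths are compared with paths of every bound.
  record Split (k : ℕ) (s t x : V) (L : List V) : Set where
    constructor split-at
    field
      {front back} : List V
      {pred}       : V
      before       : Path k s pred front
      link         : Step k pred x
      after        : Path k x t back
      parts        : L ↭ front ++ back

  seg-split : ∀ {k s t x L} → Seg k s t L → x ∈ L → x ≡ s ⊎ Split k s t x L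
  seg-split (stop a)        (here eq) = inj₁ eq
  seg-split (edge∷ e p)   (here eq) = inj₁ eq
  seg-split (heavy∷ h p) (here eq) = inj₁ eq
  seg-split (edge∷ {a = a} e p) (there x∈) with seg-split p x∈
  ... | inj₁ refl = inj₂ (split-at (path (stop a) ↭-refl) (edge e) (path p ↭-refl) ↭-refl)
  ... | inj₂ (split-at p₁ l p₂ L↭) = inj₂ (split-at (⟨ a ⟩ —⟨ edge e ⟩ p₁) l p₂ (prep a L↭))
  seg-split (heavy∷ {a = a} h p) (there x∈) with seg-split p x∈
  ... | inj₁ refl = inj₂ (split-at (path (stop a) ↭-refl) (heavy h)
    (path (seg-weaken (n≤1+n _) p) ↭-refl) ↭-refl)
  ... | inj₂ (split-at p₁ l p₂ L↭) = inj₂ (split-at (⟨ a ⟩ —⟨ heavy {0} h ⟩ p₁) (raise l)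
    (weaken (n≤1+n _) p₂) (prep a L↭))
    where
    raise : ∀ {k u v} → Step k u v → Step (suc k) u v
    raise (edge e)   = edge e
    raise (heavy h) = heavy h

  split : ∀ {k s t x L} → Path k s t L → x ∈ L → x ≡ s ⊎ Split k s t x L
  split (path p L↭) x∈ with seg-split p (∈-resp-↭ (↭-sym L↭) x∈)
  ... | inj₁ eq = inj₁ eq
  ... | inj₂ (split-at p₁ l p₂ M↭) = inj₂ (split-at p₁ l p₂ (↭-trans (↭-sym L↭) M↭))

  record Uncons (s t : V) (L : List V) : Set where
    constructor uncons-at
    field
      {tail}   : List V
      {second} : V
      link     : Adj G s second
      after    : Path 0 second t tail
      parts    : L ↭ s ∷ tail

  uncons : ∀ {s t L} → Path 0 s t L → s ≢ t → Uncons s t L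
  uncons (path (stop a)      L↭) s≢t = ⊥-elim (s≢t refl)
  uncons (path (edge∷ e p) L↭) s≢t = uncons-at e (path p ↭-refl) (↭-sym L↭)

  -- A closed route with at least one step would list `s` twice.
  loop : ∀ {k s x L} → Path k s s L → Unique L → x ∈ L → x ≡ s
  loop (path p L↭) uL x∈ =
    go p (Unique-resp-↭ (↭-sym L↭) uL) (∈-resp-↭ (↭-sym L↭) x∈)
    where
    go : ∀ {k s x L} → Seg k s s L → Unique L → x ∈ L → x ≡ s
    go (stop a)        u (here eq) = eq
    go (edge∷ e p)   u _ = ⊥-elim (Unique[x∷xs]⇒x∉xs u (end∈ (path p ↭-refl)))
    go (heavy∷ h p) u _ = ⊥-elim (Unique[x∷xs]⇒x∉xs u (end∈ (path p ↭-refl)))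

  route⇒walk : ∀ {s t L} → Seg 0 s t L → IsWalk G L
  route⇒walk (stop a)                     = one a
  route⇒walk (edge∷ e (stop b))            = cons e (one b)
  route⇒walk (edge∷ e p@(edge∷ _ _))     = cons e (route⇒walk p)

  -- Counting neighbours along a segment

  count : V → List V → ℕ
  count u L = length (filter (λ x → T? (adj G u x)) L)

  𝟙 : Bool → ℕ
  𝟙 b = if b then 1 else 0

  count-∷ : ∀ u x L → count u (x ∷ L) ≡ 𝟙 (adj G u x) + count u L
  count-∷ u x L with adj G u x
  ... | true  = refl
  ... | false = refl

  count-++ : ∀ u L M → count u (L ++ M) ≡ count u L + count u M
  count-++ u L M = trans (cong length (filter-++ _ L M)) (length-++ (filter _ L))

  count-↭ : ∀ u {L M} → L ↭ M → count u L ≡ count u M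
  count-↭ u L↭M = ↭-length (filter-↭ _ L↭M)

  -- The step between the consecutive vertices `p` and `q` is forgotten, whichever kind it is. A
  -- reroute replaces it, so only the heavy steps that remain are bounded.
  record Cut (k : ℕ) (f l p q : V) (L : List V) : Set where
    constructor cut
    field
      {i j}        : ℕ
      {front back} : List V
      before       : Seg i f p front
      after        : Seg j q l back
      bound        : i + j ≤ k
      parts        : front ++ back ≡ L

  -- The edge from `u` to `a` is charged together with the edge from `v` to the successor `b`; at
  -- most one of them exists. The edge from `v` to the first vertex stays uncharged and appears as
  -- the indicator.
  count<-∷ : ∀ {u v a b} L → (Adj G u a → Adj G v b → ⊥) →
    suc (count u L + count v L) ≤ 𝟙 (adj G v b) + length L →
    suc (count u (a ∷ L) + count v (a ∷ L)) ≤ 𝟙 (adj G v a) + suc (length L)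
  count<-∷ {u} {v} {a} {b} L never ih
    rewrite count-∷ u a L | count-∷ v a L = begin
    suc ((p + x) + (q + y))  ≡⟨ solve 4 (λ p x q y → con 1 :+ ((p :+ x) :+ (q :+ y)) :=
                                  (q :+ p) :+ (con 1 :+ (x :+ y))) refl p x q y ⟩
    (q + p) + suc (x + y)    ≤⟨ +-monoʳ-≤ (q + p) ih ⟩
    (q + p) + (r + ℓ)        ≡⟨ solve 4 (λ q p r ℓ → (q :+ p) :+ (r :+ ℓ) :=
                                  q :+ ((p :+ r) :+ ℓ)) refl q p r ℓ ⟩
    q + ((p + r) + ℓ)        ≤⟨ +-monoʳ-≤ q (+-monoˡ-≤ ℓ p+r≤1) ⟩
    q + suc ℓ                ∎
    where
    open ≤-Reasoning
    open +-*-Solver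
    p q r x y ℓ : ℕ
    p = 𝟙 (adj G u a)
    q = 𝟙 (adj G v a)
    r = 𝟙 (adj G v b)
    x = count u L
    y = count v L
    ℓ = length L
    p+r≤1 : p + r ≤ 1
    p+r≤1 with adj G u a in ua | adj G v b in vb
    ... | true  | true  = ⊥-elim (never refl refl)
    ... | true  | false = ≤-refl
    ... | false | true  = ≤-refl
    ... | false | false = z≤n

  -- Ore's counting: along the segment, the neighbours of `u` and the predecessors of neighbours of
  -- `v` are disjoint sets, and neither contains the last vertex `l`. The first vertex `f` has no
  -- predecessor and is accounted for separately.
  no-crossing⇒count< : ∀ {k f l u v L} → Seg k f l L →
    (∀ {p q} → Cut k f l p q L → Adj G u p → Adj G v q → ⊥) →
    ¬ Adj G u l → suc (count u L + count v L) ≤ 𝟙 (adj G v f) + length L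
  no-crossing⇒count< {u = u} {v} (stop a) never ua
    rewrite ¬-not ua with adj G v a
  ... | true  = ≤-refl
  ... | false = ≤-refl
  no-crossing⇒count< {u = u} {v} (edge∷ {a = a} {b} {L = L} e p) never ul =
    count<-∷ L (never (cut (stop {0} a) p ≤-refl refl))
      (no-crossing⇒count< p
        (λ (cut p₁ p₂ ≤k eq) → never (cut (edge∷ e p₁) p₂ ≤k (cong (a ∷_) eq))) ul)
  no-crossing⇒count< {u = u} {v} (heavy∷ {a = a} {b} {L = L} h p) never ul =
    count<-∷ L (never (cut (stop {0} a) p (n≤1+n _) refl))
      (no-crossing⇒count< p
        (λ (cut p₁ p₂ ≤k eq) → never (cut (heavy∷ h p₁) p₂ (s≤s ≤k) (cong (a ∷_) eq))) ul)

  record Gap (k : ℕ) (s t : V) (L : List V) : Set where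
    constructor gap
    field
      {i j}        : ℕ
      {front back} : List V
      {u v}        : V
      before       : Seg i s u front
      heavyStep    : Heavy u v
      after        : Seg j v t back
      bound        : i + j ≤ k
      parts        : front ++ back ≡ L

  -- A route without heavy steps satisfies every bound; otherwise deleting the first heavy step
  -- leaves at most `k` of them.
  first-gap : ∀ {k s t L} → Seg (suc k) s t L → Seg k s t L ⊎ Gap k s t L
  first-gap (stop a)             = inj₁ (stop a)
  first-gap (edge∷ e p) with first-gap p
  ... | inj₁ q                   = inj₁ (edge∷ e q)
  ... | inj₂ (gap p₁ h p₂ ≤k eq) = inj₂ (gap (edge∷ e p₁) h p₂ ≤k (cong (_ ∷_) eq))
  first-gap (heavy∷ h p)         = inj₂ (gap (stop {0} _) h p ≤-refl refl)

-- Removing heavy steps from a longest path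

module Longest (G : Graph n) (S : List (Fin n)) (uS : Unique S)
  (longest : ∀ {k s t L} → Paths.Path G k s t L → Unique L → length L ≤ length S) where

  open Paths G

  no-extension : ∀ {k s t v} → v ∉ S → Path k s t (v ∷ S) → ⊥
  no-extension v∉S p = 1+n≰n (longest p (∉⇒Unique v∉S uS))

  count-outside : ∀ {u v} L → (∀ {r} → r ∈ L → Adj G u r → Adj G v r → ⊥) →
    count u L + count v L ≤ length L
  count-outside [] never = z≤n
  count-outside {u} {v} (r ∷ L) never with count-outside L (never ∘ there)
  ... | ih rewrite count-∷ u r L | count-∷ v r L with adj G u r in ur | adj G v r in vr
  ...   | true  | true  = ⊥-elim (never (here refl) ur vr)
  ...   | true  | false = s≤s ih
  ...   | false | true  = ≤-trans (≤-reflexive (+-suc _ _)) (s≤s ih)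
  ...   | false | false = m≤n⇒m≤1+n ih

  -- If u~p, v~q for consecutive p, q on either side of a heavy step u-v, both
  -- steps p-q and u-v can be replaced by edges. If this never applies then u
  -- and v have too few neighbours.
  remove-gap : ∀ {k s t} → (∀ {s′ t′} → ¬ Path k s′ t′ S) → ¬ Path (suc k) s t S
  remove-gap {k} {s} {t} minimal (path p L↭) with first-gap p
  ... | inj₁ q = minimal (path q L↭)
  ... | inj₂ (gap {i} {j} {A} {B} {u} {v} p₁ h p₂ ≤k refl) = <⇒≱ deg< h
    where
    P₁ : Path i s u A
    P₁ = path p₁ ↭-refl
    P₂ : Path j v t B
    P₂ = path p₂ ↭-refl

    -- An edge joining the two pieces, with either one possibly reversed, would save the heavy step.
    uv : ¬ Adj G u v
    uv e = minimal (weaken ≤k (P₁ —⟨ edge {0} e ⟩ P₂) ▷ L↭)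
    vs : ¬ Adj G v s
    vs e = minimal (weaken ≤k (rev P₁ —⟨ edge {0} (Adj-sym e) ⟩ P₂) ▷ L↭)
    ut : ¬ Adj G u t
    ut e = minimal (weaken ≤k (P₁ —⟨ edge {0} e ⟩ rev P₂) ▷ L↭)

    front : suc (count u A + count v A) ≤ length A
    front = subst (λ b → suc (count u A + count v A) ≤ 𝟙 b + length A) (¬-not vs)
      (no-crossing⇒count< p₁ crossing (λ e → Adj⇒≢ e refl))
      where
      crossing : ∀ {p q} → Cut i s u p q A → Adj G u p → Adj G v q → ⊥
      crossing (cut {i₁} {i₂} {A₁} {A₂} c₁ c₂ ≤i refl) up vq = minimal (weaken
        (≤-trans (≤-reflexive (sym (+-assoc i₁ i₂ j))) (≤-trans (+-monoˡ-≤ j ≤i) ≤k))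
        (path c₁ ↭-refl —⟨ edge {0} (Adj-sym up) ⟩
         rev (path c₂ ↭-refl) —⟨ edge {0} (Adj-sym vq) ⟩ P₂)
        ▷ ↭-trans (↭-reflexive (sym (++-assoc A₁ A₂ B))) L↭)

    back : suc (count u B + count v B) ≤ length B
    back = subst (λ b → suc (count u B + count v B) ≤ 𝟙 b + length B) (irrefl G v)
      (no-crossing⇒count< p₂ crossing ut)
      where
      crossing : ∀ {p q} → Cut j v t p q B → Adj G u p → Adj G v q → ⊥
      crossing (cut {j₁} {j₂} {B₁} {B₂} c₁ c₂ ≤j refl) up vq = minimal (weaken
        (≤-trans (+-monoʳ-≤ i ≤j) ≤k)
        (P₁ —⟨ edge {0} up ⟩ rev (path c₁ ↭-refl) —⟨ edge {0} vq ⟩ path c₂ ↭-refl)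
        ▷ L↭)

    R : List V
    R = outside S

    -- A vertex off the path adjacent to both `u` and `v` could be inserted in the gap, giving a
    -- longer path.
    rest : count u R + count v R ≤ length R
    rest = count-outside R λ {r} r∈R ur vr → no-extension (∈-outside⁻ S r∈R)
      (P₁ —⟨ edge {0} ur ⟩ ⟨ r ⟩ —⟨ edge {0} (Adj-sym vr) ⟩ P₂
       ▷ ↭-trans (↭-solve 3 (λ a r b → a ⊕ r ⊕ b ⊜ r ⊕ a ⊕ b) ↭-refl A [ r ] B)
           (prep r L↭))

    all↭ : allFin n ↭ (A ++ B) ++ R
    all↭ = ↭-trans (allFin↭ uS) (++⁺ (↭-sym L↭) ↭-refl)

    deg≡ : ∀ x → deg G x ≡ count x A + count x B + count x R
    -- `deg G x` is `count x (allFin n)` by definition.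
    deg≡ x = trans (count-↭ x all↭)
      (trans (count-++ x (A ++ B) R) (cong (_+ count x R) (count-++ x A B)))

    n≡ : n ≡ length A + length B + length R
    n≡ = trans (sym (length-tabulate (λ i → i)))
      (trans (↭-length all↭) (trans (length-++ (A ++ B)) (cong (_+ length R) (length-++ A))))

    -- Each of the two pieces loses one, so the degree sum is at most `n - 2`, just short of heavy.
    deg< : deg G u + deg G v < n ∸ 1
    deg< = ∸-monoˡ-≤ 1 (begin
      2 + (deg G u + deg G v)
        ≡⟨ cong (2 +_) (cong₂ _+_ (deg≡ u) (deg≡ v)) ⟩
      2 + ((count u A + count u B + count u R) + (count v A + count v B + count v R))
        ≡⟨ solve 6 (λ a b c d e f → con 2 :+ ((a :+ b :+ c) :+ (d :+ e :+ f)) :=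
             (con 1 :+ (a :+ d)) :+ (con 1 :+ (b :+ e)) :+ (c :+ f)) refl
             (count u A) (count u B) (count u R) (count v A) (count v B) (count v R) ⟩
      suc (count u A + count v A) + suc (count u B + count v B) + (count u R + count v R)
        ≤⟨ +-mono-≤ (+-mono-≤ front back) rest ⟩
      length A + length B + length R
        ≡⟨ n≡ ⟨
      n ∎)
      where
      open ≤-Reasoning
      open +-*-Solver

  -- Contrapositive form of the closure property: a longest path with heavy steps can be rerouted to
  -- a path of `G` on the same vertices.
  remove-gaps : (∀ {s t} → ¬ Path 0 s t S) → ∀ k {s t} → ¬ Path k s t S
  remove-gaps none zero    = none
  remove-gaps none (suc k) = remove-gap (remove-gaps none k)

-- High vertices and degree sums

module Degrees (G : Graph n) where
  open Paths G

  High : V → Set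
  High v = n ∸ 1 ≤ deg G v + deg G v

  Heavy⇒High : ∀ u v → Heavy u v → High u ⊎ High v
  Heavy⇒High u v h with ≤-total (deg G u) (deg G v)
  ... | inj₁ u≤v = inj₂ (≤-trans h (+-monoˡ-≤ (deg G v) u≤v))
  ... | inj₂ v≤u = inj₁ (≤-trans h (+-monoʳ-≤ (deg G u) v≤u))

  High⇒Heavy : ∀ {u v} → High u → High v → Heavy u v
  High⇒Heavy {u} {v} hu hv with ≤-total (deg G u) (deg G v)
  ... | inj₁ u≤v = ≤-trans hu (+-monoʳ-≤ (deg G u) u≤v)
  ... | inj₂ v≤u = ≤-trans hv (+-monoˡ-≤ (deg G v) v≤u)

  neighbours : V → List V
  neighbours v = filter (λ u → T? (adj G v u)) (allFin n)

  ∈-neighbours⁻ : ∀ {u v} → v ∈ neighbours u → Adj G u v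
  ∈-neighbours⁻ v∈ = Equivalence.to T-≡ (proj₂ (∈-filter⁻ _ {xs = allFin n} v∈))

  ∈-neighbours⁺ : ∀ {u v} → Adj G u v → v ∈ neighbours u
  ∈-neighbours⁺ e = ∈-filter⁺ _ (∈-allFin _) (Equivalence.from T-≡ e)

  neighbours-unique : ∀ v → Unique (neighbours v)
  neighbours-unique v = Unique.filter⁺ _ (allFin⁺ n)

  -- The two neighbourhoods and `M` are pairwise disjoint.
  disjoint⇒deg-sum≤ : ∀ p q {M} → (∀ {v} → Adj G p v → Adj G q v → ⊥) → Unique M →
    (∀ {v} → v ∈ M → ¬ Adj G p v × ¬ Adj G q v) → deg G p + deg G q + length M ≤ n
  disjoint⇒deg-sum≤ p q {M} pq uM missed = begin
    deg G p + deg G q + length M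
      ≡⟨ cong (_+ length M) (length-++ (neighbours p)) ⟨
    length (neighbours p ++ neighbours q) + length M
      ≡⟨ length-++ (neighbours p ++ neighbours q) ⟨
    length ((neighbours p ++ neighbours q) ++ M)
      ≤⟨ Unique⇒length≤ (Unique.++⁺
           (Unique.++⁺ (neighbours-unique p) (neighbours-unique q)
             (λ (v∈p , v∈q) → pq (∈-neighbours⁻ v∈p) (∈-neighbours⁻ v∈q)))
           uM
           (λ (v∈pq , v∈M) → disjoint (∈-++⁻ (neighbours p) v∈pq) (missed v∈M))) ⟩
    n ∎
    where
    open ≤-Reasoning
    disjoint : ∀ {v} → v ∈ neighbours p ⊎ v ∈ neighbours q → ¬ Adj G p v × ¬ Adj G q v → ⊥
    disjoint (inj₁ v∈p) (¬pv , _) = ¬pv (∈-neighbours⁻ v∈p)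
    disjoint (inj₂ v∈q) (_ , ¬qv) = ¬qv (∈-neighbours⁻ v∈q)

  record ThreeNeighbours (p : V) : Set where
    field
      {x y z} : V
      px : Adj G p x
      py : Adj G p y
      pz : Adj G p z
      x≢y : x ≢ y
      x≢z : x ≢ z
      y≢z : y ≢ z

  deg≥3⇒ThreeNeighbours : ∀ p → 3 ≤ deg G p → ThreeNeighbours p
  deg≥3⇒ThreeNeighbours p = go (neighbours p) (neighbours-unique p) ∈-neighbours⁻
    where
    go : ∀ L → Unique L → (∀ {v} → v ∈ L → Adj G p v) → 3 ≤ length L → ThreeNeighbours p
    go (x ∷ y ∷ z ∷ L) ((x≢y ∷ x≢z ∷ _) ∷ (y≢z ∷ _) ∷ _) nb (s≤s (s≤s (s≤s _))) = record
      { px = nb (here refl) ; py = nb (there (here refl)) ; pz = nb (there (there (here refl)))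
      ; x≢y = x≢y ; x≢z = x≢z ; y≢z = y≢z }

  -- Here `n - 1` is at least 5, while a degree of at most 2 doubles to at most 4.
  High⇒deg≥3 : ∀ {p} → 6 ≤ n → High p → 3 ≤ deg G p
  High⇒deg≥3 {p} 6≤n hp with 3 ≤? deg G p
  ... | yes 3≤d = 3≤d
  ... | no  3≰d = ⊥-elim (<⇒≱ (s≤s (≤-trans hp (+-mono-≤ d≤2 d≤2))) (∸-monoˡ-≤ 1 6≤n))
    where
    d≤2 : deg G p ≤ 2
    d≤2 = ≤-pred (≰⇒> 3≰d)

-- Longest paths in the triangle-free case

module TriangleFree (G : Graph n)
  (claw : ClawO-1Heavy G)
  (triangle-free : ∀ {x y z} → Adj G x y → Adj G y z → Adj G x z → ⊥)
  (S : List (Fin n)) (uS : Unique S)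
  (longest : ∀ {k s t L} → Paths.Path G k s t L → Unique L → length L ≤ length S)
  (w : Fin n) (w∉S : w ∉ S) (x₀ : Fin n) (x₀∈S : x₀ ∈ S) (wx₀ : Adj G w x₀) where

  open Paths G
  open Degrees G
  open Longest G S uS longest

  -- Without triangles, three distinct neighbours of `c` always induce a claw.
  claw-heavy : ∀ {c x y z} → Adj G c x → Adj G c y → Adj G c z → x ≢ y → x ≢ z → y ≢ z →
    Heavy x y ⊎ Heavy x z ⊎ Heavy y z
  claw-heavy cx cy cz x≢y x≢z y≢z = claw _ _ _ _
    ( cx , cy , cz
    , (λ xy → triangle-free cx xy cy) , (λ xz → triangle-free cx xz cz)
    , (λ yz → triangle-free cy yz cz) , x≢y , x≢z , y≢z)

  -- Adjacency in the graph with all heavy pairs added.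
  Close : V → V → Set
  Close = Step 1

  w≢ : ∀ {v} → v ∈ S → w ≢ v
  w≢ v∈S refl = w∉S v∈S

  ¬Close-w-start : ∀ {k s t} → Path k s t S → ¬ Close w s
  ¬Close-w-start p c = no-extension w∉S (⟨ w ⟩ —⟨ c ⟩ p)

  -- Otherwise the path closes up to a cycle, and entering the cycle from `w` at `x₀` gives a longer
  -- path.
  ¬Close-ends : ∀ {k s t} → Path k s t S → ¬ Close s t
  ¬Close-ends p c with split p x₀∈S
  ... | inj₁ refl = ¬Close-w-start p (edge wx₀)
  ... | inj₂ (split-at {front} {back} p₁ _ p₂ parts) = no-extension w∉S
    (⟨ w ⟩ —⟨ edge {0} wx₀ ⟩ p₂ —⟨ Step-sym c ⟩ p₁
      ▷ prep w (↭-trans (++-comm back front) (↭-sym parts)))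

  start-neighbour∈S : ∀ {k s t y} → Path k s t S → Adj G y s → y ∈ S
  start-neighbour∈S {y = y} p ys with y ∈? S
  ... | yes y∈S = y∈S
  ... | no  y∉S = ⊥-elim (no-extension y∉S (⟨ y ⟩ —⟨ edge {0} ys ⟩ p))

  record Around (s t x : V) : Set where
    constructor around-at
    field
      {A B}  : List V
      {a b}  : V
      before : Path 0 s a A
      ax     : Adj G a x
      xb     : Adj G x b
      after  : Path 0 b t B
      parts  : S ↭ A ++ x ∷ B

  flip : ∀ {s t x} → Around s t x → Around t s x
  flip {x = x} (around-at {A} {B} p ax xb q parts) =
    around-at (rev q) (Adj-sym xb) (Adj-sym ax) (rev p)
      (↭-trans parts (↭-solve 3 (λ A x B → A ⊕ x ⊕ B ⊜ B ⊕ x ⊕ A) ↭-refl A [ x ] B))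

  around : ∀ {s t y} → Path 0 s t S → y ∈ S → y ≢ s → y ≢ t → Around s t y
  around p y∈S y≢s y≢t with split p y∈S
  ... | inj₁ y≡s = ⊥-elim (y≢s y≡s)
  ... | inj₂ (split-at p₁ l p₂ parts) with uncons p₂ y≢t
  ...   | uncons-at e p₃ parts′ =
    around-at p₁ (Step₀ l) e p₃ (↭-trans parts (++⁺ ↭-refl parts′))

  -- A neighbour of `w` is not an end of the path, since `w` could be attached there.
  around-neighbour : ∀ {s t x} → Path 0 s t S → Adj G w x → x ∈ S → Around s t x
  around-neighbour p wx x∈S = around p x∈S
    (λ { refl → ¬Close-w-start p (edge wx) }) (λ { refl → ¬Close-w-start (rev p) (edge wx) })

  module AroundFacts {s t x : V} (r : Around s t x) where
    open Around r public

    to-S : ∀ {M v} → M ↭ v ∷ A ++ x ∷ B → M ↭ v ∷ S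
    to-S {v = v} M↭ = ↭-trans M↭ (prep v (↭-sym parts))

    unique : Unique (A ++ x ∷ B)
    unique = Unique-resp-↭ parts uS

    A⊆S : ∀ {v} → v ∈ A → v ∈ S
    A⊆S v∈A = ∈-resp-↭ (↭-sym parts) (∈-++⁺ˡ v∈A)

    B⊆S : ∀ {v} → v ∈ B → v ∈ S
    B⊆S v∈B = ∈-resp-↭ (↭-sym parts) (∈-++⁺ʳ A (there v∈B))

    A≢B : ∀ {u v} → u ∈ A → v ∈ B → u ≢ v
    A≢B u∈A v∈B = Unique⇒disjoint A unique u∈A (there v∈B)

    s∈A : s ∈ A
    s∈A = start∈ before
    a∈A : a ∈ A
    a∈A = end∈ before
    b∈B : b ∈ B
    b∈B = start∈ after
    t∈B : t ∈ B
    t∈B = end∈ after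

    -- Otherwise `w` could be inserted between `a` and `x`.
    ¬Close-w-pred : Adj G w x → ¬ Close w a
    ¬Close-w-pred wx c = no-extension w∉S
      (before —⟨ Step-sym c ⟩ ⟨ w ⟩ —⟨ edge {0} wx ⟩ ⟨ x ⟩ —⟨ edge {0} xb ⟩ after
        ▷ to-S (↭-solve 4 (λ A w x B → A ⊕ w ⊕ x ⊕ B ⊜ w ⊕ A ⊕ x ⊕ B) ↭-refl A [ w ] [ x ] B))

    -- Otherwise start at `w`, follow the path from `x` to `t`, jump to `a` and run back to `s`.
    ¬Close-end-pred : Adj G w x → ¬ Close t a
    ¬Close-end-pred wx c = no-extension w∉S
      (⟨ w ⟩ —⟨ edge {0} wx ⟩ ⟨ x ⟩ —⟨ edge {0} xb ⟩ after —⟨ c ⟩ rev before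
        ▷ to-S (↭-solve 4 (λ A w x B → w ⊕ x ⊕ B ⊕ A ⊜ w ⊕ A ⊕ x ⊕ B) ↭-refl A [ w ] [ x ] B))

  module AroundNeighbour {s t x : V} (r : Around s t x) (wx : Adj G w x) where
    open AroundFacts r public
    private module F = AroundFacts (flip r)

    w≁a : ¬ Close w a
    w≁a = ¬Close-w-pred wx
    w≁b : ¬ Close w b
    w≁b = F.¬Close-w-pred wx
    s≁b : ¬ Close s b
    s≁b = F.¬Close-end-pred wx

    -- In the claw at `x` with leaves `w`, `a`, `b`, neither pair containing `w` is heavy.
    a-b-heavy : Heavy a b
    a-b-heavy with claw-heavy (Adj-sym wx) (Adj-sym ax) xb
      (w≢ (A⊆S a∈A)) (w≢ (B⊆S b∈B)) (A≢B a∈A b∈B)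
    ... | inj₁ h        = ⊥-elim (w≁a (heavy h))
    ... | inj₂ (inj₁ h) = ⊥-elim (w≁b (heavy h))
    ... | inj₂ (inj₂ h) = h

    s≢a : s ≢ a
    s≢a refl = s≁b (heavy a-b-heavy)

  -- Such a `y` would be an interior vertex of the path, and with its successor `b` it would centre
  -- a claw with leaves `w`, `s`, `b`, no two of them heavy.
  no-common-w-start : ∀ {s t y} → Path 0 s t S → Adj G y w → Adj G y s → ⊥
  no-common-w-start p yw ys = contra
    where
    r = around-neighbour p (Adj-sym yw) (start-neighbour∈S p ys)
    open AroundNeighbour r (Adj-sym yw)
    contra : ⊥
    contra with claw-heavy yw ys xb (w≢ (A⊆S s∈A)) (w≢ (B⊆S b∈B)) (A≢B s∈A b∈B)
    ... | inj₁ h        = ¬Close-w-start p (heavy h)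
    ... | inj₂ (inj₁ h) = w≁b (heavy h)
    ... | inj₂ (inj₂ h) = s≁b (heavy h)

  -- High vertices adjacent to both ends

  module CommonNeighbourOfEnds {s t c : V} (p : Path 0 s t S) (high : High c)
    (cs : Adj G c s) (ct : Adj G c t) (r : Around s t c) where
    open AroundFacts r

    s≁t : ¬ Close s t
    s≁t = ¬Close-ends p

    -- The edges from `c` to both ends reroute the path on the same vertices, with ends `a`, `t`
    -- here and `s`, `b` in the next lemma. A link from `a` to `b` would even make the adjacent
    -- vertices `c` and `t` the ends.
    a≁t : ¬ Close a t
    a≁t = ¬Close-ends (rev before —⟨ edge {0} (Adj-sym cs) ⟩ ⟨ c ⟩ —⟨ edge {0} xb ⟩ after
      ▷ ↭-sym parts)

    s≁b : ¬ Close s b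
    s≁b = ¬Close-ends (before —⟨ edge {0} ax ⟩ ⟨ c ⟩ —⟨ edge {0} ct ⟩ rev after
      ▷ ↭-sym parts)

    a≁b : ¬ Close a b
    a≁b l = ¬Close-ends
      (⟨ c ⟩ —⟨ edge {0} cs ⟩ before —⟨ l ⟩ after
        ▷ ↭-trans (↭-solve 3 (λ A c B → c ⊕ A ⊕ B ⊜ A ⊕ c ⊕ B) ↭-refl A [ c ] B) (↭-sym parts))
      (edge ct)

    -- In the claw at `c` with leaves `s`, `b`, `t`, the pairs containing `s` are not heavy.
    b≡t⊎heavy : b ≡ t ⊎ Heavy b t
    b≡t⊎heavy with b Fin.≟ t
    ... | yes b≡t = inj₁ b≡t
    ... | no  b≢t with claw-heavy cs xb ct (A≢B s∈A b∈B) (A≢B s∈A t∈B) b≢t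
    ...   | inj₁ h        = ⊥-elim (s≁b (heavy h))
    ...   | inj₂ (inj₁ h) = ⊥-elim (s≁t (heavy h))
    ...   | inj₂ (inj₂ h) = inj₂ h

    -- If c is the second vertex then the rest of the path closes up to a cycle
    -- through the heavy pair b, t; enter it from w at x₀ and leave it for c.
    pred-is-start : s ≡ a → ⊥
    pred-is-start refl = locate (∈-++⁻ A (∈-resp-↭ parts x₀∈S))
      where
      S≢ends : x₀ ≢ s × x₀ ≢ t
      S≢ends = (λ { refl → ¬Close-w-start p (edge wx₀) })
             , (λ { refl → ¬Close-w-start (rev p) (edge wx₀) })

      in-B : Heavy b t → x₀ ∈ B → ⊥
      in-B bt x₀∈B with split after x₀∈B
      -- Here `x₀` is `b`. Its neighbours on the path, `c` and the next vertex, form a heavy pair,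
      -- so the cycle is run from `b` to `t`, back to that next vertex, and left for `c`.
      ... | inj₁ refl with uncons after (proj₂ S≢ends)
      ...   | uncons-at {E} be q parts′ = no-extension w∉S
        (⟨ w ⟩ —⟨ edge {0} wx₀ ⟩ ⟨ b ⟩ —⟨ heavy {0} bt ⟩ rev q —⟨ heavy {0} (Heavy-sym {c} c-e) ⟩
         ⟨ c ⟩ —⟨ edge {0} cs ⟩ before
          ▷ to-S (↭-trans
              (↭-solve 5 (λ w b E c A → w ⊕ b ⊕ E ⊕ c ⊕ A ⊜ w ⊕ A ⊕ c ⊕ b ⊕ E) ↭-refl
                [ w ] [ b ] E [ c ] A)
              (prep w (++⁺ˡ A (prep c (↭-sym parts′))))))
        where
        r′ : Around s t b
        r′ = around-at (before —⟨ edge {0} ax ⟩ ⟨ c ⟩) xb be q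
          (↭-trans parts (↭-trans (++⁺ˡ A (prep c parts′)) (↭-reflexive (sym (++-assoc A [ c ] _)))))
        c-e = AroundNeighbour.a-b-heavy r′ wx₀
      in-B bt x₀∈B | inj₂ (split-at {D} {pred = d} q₁ l q₂ parts₁) with uncons q₂ (proj₂ S≢ends)
      -- One of the path neighbours `d`, `e` of `x₀` is high, hence heavy with `c`. The cycle is run
      -- from `x₀` in the direction away from it, so as to end there.
      ...   | uncons-at {E} {e} xe q₃ parts₂ with Heavy⇒High d e (AroundNeighbour.a-b-heavy r′ wx₀)
        where
        parts₃ : S ↭ (A ++ c ∷ D) ++ x₀ ∷ E
        parts₃ = ↭-trans parts (↭-trans
          (++⁺ˡ A (prep c (↭-trans parts₁ (++⁺ˡ D parts₂))))
          (↭-reflexive (sym (++-assoc A (c ∷ D) (x₀ ∷ E)))))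
        r′ : Around s t x₀
        r′ = around-at (before —⟨ edge {0} ax ⟩ ⟨ c ⟩ —⟨ edge {0} xb ⟩ q₁) (Step₀ l) xe q₃ parts₃
      ...     | inj₁ hd = no-extension w∉S
        (⟨ w ⟩ —⟨ edge {0} wx₀ ⟩ ⟨ x₀ ⟩ —⟨ edge {0} xe ⟩ q₃ —⟨ heavy {0} (Heavy-sym {b} bt) ⟩ q₁
          —⟨ heavy {0} (High⇒Heavy hd high) ⟩ ⟨ c ⟩ —⟨ edge {0} cs ⟩ before
          ▷ to-S (↭-trans
              (↭-solve 6 (λ w x E D c A → w ⊕ x ⊕ E ⊕ D ⊕ c ⊕ A ⊜ w ⊕ A ⊕ c ⊕ D ⊕ x ⊕ E) ↭-refl
                [ w ] [ x₀ ] E D [ c ] A)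
              (prep w (++⁺ˡ A (prep c (↭-sym (↭-trans parts₁ (++⁺ˡ D parts₂))))))))
      ...     | inj₂ he = no-extension w∉S
        (⟨ w ⟩ —⟨ edge {0} wx₀ ⟩ ⟨ x₀ ⟩ —⟨ Step-sym l ⟩ rev q₁ —⟨ heavy {0} bt ⟩ rev q₃
          —⟨ heavy {0} (High⇒Heavy he high) ⟩ ⟨ c ⟩ —⟨ edge {0} cs ⟩ before
          ▷ to-S (↭-trans
              (↭-solve 6 (λ w x E D c A → w ⊕ x ⊕ D ⊕ E ⊕ c ⊕ A ⊜ w ⊕ A ⊕ c ⊕ D ⊕ x ⊕ E) ↭-refl
                [ w ] [ x₀ ] E D [ c ] A)
              (prep w (++⁺ˡ A (prep c (↭-sym (↭-trans parts₁ (++⁺ˡ D parts₂))))))))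

      locate : x₀ ∈ A ⊎ x₀ ∈ c ∷ B → ⊥
      locate (inj₁ x₀∈A) = proj₁ S≢ends (loop before (Unique-++⁻ˡ A unique) x₀∈A)
      locate (inj₂ (here refl)) = no-common-w-start p (Adj-sym wx₀) cs
      locate (inj₂ (there x₀∈B)) with b≡t⊎heavy
      ... | inj₂ bt   = in-B bt x₀∈B
      ... | inj₁ refl = proj₂ S≢ends (loop after unique-B x₀∈B)
        where
        unique-B : Unique B
        unique-B with Unique-++⁻ʳ A unique
        ... | _ ∷ uB = uB

  -- Since `c` is next to neither end of the path, `b`, `t` and `a`, `s` are heavy pairs. Each
  -- contains a high vertex, and these two would be close, but every choice of them has been
  -- excluded.
  no-common-ends : ∀ {s t c} → Path 0 s t S → High c → Adj G c s → Adj G c t → ⊥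
  no-common-ends {s} {t} {c} p high cs ct = contra (s Fin.≟ a) F.b≡t⊎heavy R.b≡t⊎heavy
    where
    r = around p (start-neighbour∈S p cs) (Adj⇒≢ cs) (Adj⇒≢ ct)
    open AroundFacts r
    module F = CommonNeighbourOfEnds p high cs ct r
    module R = CommonNeighbourOfEnds (rev p) high ct cs (flip r)
    contra : Dec (s ≡ a) → b ≡ t ⊎ Heavy b t → a ≡ s ⊎ Heavy a s → ⊥
    contra (yes s≡a) _ _ = F.pred-is-start s≡a
    contra (no _) (inj₁ b≡t) _ = R.pred-is-start (sym b≡t)
    contra (no s≢a) _ (inj₁ a≡s) = s≢a (sym a≡s)
    contra (no _) (inj₂ bt) (inj₂ as) with Heavy⇒High b t bt | Heavy⇒High a s as
    ... | inj₁ hb | inj₁ ha = F.a≁b (heavy (High⇒Heavy ha hb))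
    ... | inj₁ hb | inj₂ hs = F.s≁b (heavy (High⇒Heavy hs hb))
    ... | inj₂ ht | inj₁ ha = F.a≁t (heavy (High⇒Heavy ha ht))
    ... | inj₂ ht | inj₂ hs = F.s≁t (heavy (High⇒Heavy hs ht))

  ThreeNeighbours⇒heavy : ∀ {v} → ThreeNeighbours v →
    ∃[ q ] ∃[ q′ ] (Adj G v q × Adj G v q′ × q ≢ q′ × Heavy q q′)
  ThreeNeighbours⇒heavy {v} nbs = choose (claw-heavy px py pz x≢y x≢z y≢z)
    where
    open ThreeNeighbours nbs
    choose : Heavy x y ⊎ Heavy x z ⊎ Heavy y z →
      ∃[ q ] ∃[ q′ ] (Adj G v q × Adj G v q′ × q ≢ q′ × Heavy q q′)
    choose (inj₁ h)        = x , y , px , py , x≢y , h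
    choose (inj₂ (inj₁ h)) = x , z , px , pz , x≢z , h
    choose (inj₂ (inj₂ h)) = y , z , py , pz , y≢z , h

  -- Exact degrees of high vertices

  module Contradiction {s t : V} (p : Path 0 s t S) (r₀ : Around s t x₀) where
    open AroundNeighbour r₀ wx₀

    s≢t : s ≢ t
    s≢t = A≢B s∈A t∈B

    abstract
      -- The vertices `w`, `s`, `a`, `x₀`, `b`, `t` are distinct.
      6≤n : 6 ≤ n
      6≤n = begin
        6                            ≤⟨ s≤s (+-mono-≤ (two s∈A a∈A s≢a) (s≤s (two b∈B t∈B b≢t))) ⟩
        suc (length A + length (x₀ ∷ B))  ≡⟨ cong suc (length-++ A) ⟨
        suc (length (A ++ x₀ ∷ B))   ≡⟨ cong suc (↭-length parts) ⟨
        length (w ∷ S)               ≤⟨ Unique⇒length≤ (∉⇒Unique w∉S uS) ⟩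
        n                            ∎
        where
        open ≤-Reasoning
        b≢t : b ≢ t
        b≢t b≡t = AroundNeighbour.s≢a (flip r₀) wx₀ (sym b≡t)
        two : ∀ {u v : V} {L} → u ∈ L → v ∈ L → u ≢ v → 2 ≤ length L
        two {L = _ ∷ []}    (here refl) (here refl) u≢v = ⊥-elim (u≢v refl)
        two {L = _ ∷ _ ∷ _} _ _ _ = s≤s (s≤s z≤n)

    abstract
      heavy-neighbours : ∀ {v} → High v →
        ∃[ q ] ∃[ q′ ] (Adj G v q × Adj G v q′ × q ≢ q′ × Heavy q q′)
      heavy-neighbours {v} hv = ThreeNeighbours⇒heavy (deg≥3⇒ThreeNeighbours v (High⇒deg≥3 6≤n hv))

    abstract
      high-neighbour : ∀ {v} → High v → ∃[ q ] (Adj G v q × High q)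
      high-neighbour hv with heavy-neighbours hv
      ... | q , q′ , vq , vq′ , _ , h with Heavy⇒High q q′ h
      ...   | inj₁ hq  = q , vq , hq
      ...   | inj₂ hq′ = q′ , vq′ , hq′

    T : Fin 3 → V
    T zero             = w
    T (suc zero)       = s
    T (suc (suc zero)) = t

    T-injective : ∀ {i j} → i ≢ j → T i ≢ T j
    T-injective {zero}           {zero}           i≢j = ⊥-elim (i≢j refl)
    T-injective {zero}           {suc zero}       i≢j = w≢ (A⊆S s∈A)
    T-injective {zero}           {suc (suc zero)} i≢j = w≢ (B⊆S t∈B)
    T-injective {suc zero}       {zero}           i≢j = ≢-sym (w≢ (A⊆S s∈A))
    T-injective {suc zero}       {suc zero}       i≢j = ⊥-elim (i≢j refl)
    T-injective {suc zero}       {suc (suc zero)} i≢j = s≢t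
    T-injective {suc (suc zero)} {zero}           i≢j = ≢-sym (w≢ (B⊆S t∈B))
    T-injective {suc (suc zero)} {suc zero}       i≢j = ≢-sym s≢t
    T-injective {suc (suc zero)} {suc (suc zero)} i≢j = ⊥-elim (i≢j refl)

    T-apart : ∀ {i j v} → High v → i ≢ j → Adj G v (T i) → Adj G v (T j) → ⊥
    T-apart {zero}           {zero}           hv i≢j vi vj = i≢j refl
    T-apart {zero}           {suc zero}       hv i≢j vi vj = no-common-w-start p vi vj
    T-apart {zero}           {suc (suc zero)} hv i≢j vi vj = no-common-w-start (rev p) vi vj
    T-apart {suc zero}       {zero}           hv i≢j vi vj = no-common-w-start p vj vi
    T-apart {suc zero}       {suc zero}       hv i≢j vi vj = i≢j refl
    T-apart {suc zero}       {suc (suc zero)} hv i≢j vi vj = no-common-ends p hv vi vj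
    T-apart {suc (suc zero)} {zero}           hv i≢j vi vj = no-common-w-start (rev p) vj vi
    T-apart {suc (suc zero)} {suc zero}       hv i≢j vi vj = no-common-ends p hv vj vi
    T-apart {suc (suc zero)} {suc (suc zero)} hv i≢j vi vj = i≢j refl

    two-missed : ∀ {v} → High v → ∃[ i ] ∃[ j ] (i ≢ j × ¬ Adj G v (T i) × ¬ Adj G v (T j))
    two-missed {v} hv with Adj? G v (T zero) | Adj? G v (T (suc zero))
    ... | yes v0 | _ = suc zero , suc (suc zero) , (λ ())
                     , T-apart hv (λ ()) v0 , T-apart hv (λ ()) v0
    ... | no ¬v0 | yes v1 = zero , suc (suc zero) , (λ ()) , ¬v0 , T-apart hv (λ ()) v1
    ... | no ¬v0 | no ¬v1 = zero , suc zero , (λ ()) , ¬v0 , ¬v1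

    -- Of the two vertices that `v` misses, `u` is adjacent to at most one.
    common-missed : ∀ {u v} → High u → High v → ∃[ i ] (¬ Adj G u (T i) × ¬ Adj G v (T i))
    common-missed {u} hu hv with two-missed hv
    ... | i , j , i≢j , ¬vi , ¬vj with Adj? G u (T i)
    ...   | no  ¬ui = i , ¬ui , ¬vi
    ...   | yes ui  = j , T-apart hu i≢j ui , ¬vj

    -- Let `q` be a high neighbour of `v`. The neighbourhoods of `v` and `q` are disjoint and miss a
    -- common `T i`, so the degrees sum to at most `n - 1`. As `q` is high, its degree is no smaller
    -- than that of `v`.
    High⇒deg+deg≤ : ∀ {v} → High v → deg G v + deg G v ≤ n ∸ 1
    High⇒deg+deg≤ {v} hv with high-neighbour hv
    ... | q , vq , hq with common-missed hv hq
    ...   | i , ¬vi , ¬qi = ≤-trans (+-monoʳ-≤ (deg G v) v≤q) sum≤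
      where
      sum≤ : deg G v + deg G q ≤ n ∸ 1
      sum≤ = ∸-monoˡ-≤ 1 (≤-trans (≤-reflexive (+-comm 1 _))
        (disjoint⇒deg-sum≤ v q {[ T i ]} (λ vz qz → triangle-free vq qz vz) ([] ∷ [])
          (λ { (here refl) → ¬vi , ¬qi })))
      v≤q : deg G v ≤ deg G q
      v≤q = +-cancelʳ-≤ (deg G q) (deg G v) (deg G q) (≤-trans sum≤ hq)

    -- If `v` is high, twice its degree is at most `n - 1`, so in a heavy pair `u` has at least the
    -- degree of `v`.
    Heavy⇒Highˡ : ∀ {u v} → Heavy u v → High u
    Heavy⇒Highˡ {u} {v} h with Heavy⇒High u v h
    ... | inj₁ hu = hu
    ... | inj₂ hv = ≤-trans h (+-monoʳ-≤ (deg G u)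
      (+-cancelʳ-≤ (deg G v) (deg G v) (deg G u) (≤-trans (High⇒deg+deg≤ hv) h)))

    Heavy⇒Highʳ : ∀ {u v} → Heavy u v → High v
    Heavy⇒Highʳ {u} {v} h = Heavy⇒Highˡ {v} {u} (Heavy-sym {u} {v} h)

    -- Otherwise `v` and a high neighbour `q` have disjoint neighbourhoods with two common missed
    -- vertices, so that their degree sum is at most `n - 2`.
    High⇒hits-T : ∀ {v} → High v → ¬ (∀ i → ¬ Adj G v (T i))
    High⇒hits-T {v} hv missed with high-neighbour hv
    ... | q , vq , hq with two-missed hq
    ...   | i , j , i≢j , ¬qi , ¬qj = <⇒≱ sum< (High⇒Heavy hv hq)
      where
      sum< : suc (deg G v + deg G q) ≤ n ∸ 1
      sum< = ∸-monoˡ-≤ 1 (≤-trans (≤-reflexive (+-comm 2 _))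
        (disjoint⇒deg-sum≤ v q {T i ∷ [ T j ]} (λ vz qz → triangle-free vq qz vz)
          ((T-injective i≢j ∷ []) ∷ [] ∷ [])
          (λ { (here refl) → missed i , ¬qi ; (there (here refl)) → missed j , ¬qj })))

    -- Neighbours of the ends and of the outside vertex

    ¬High-start : ∀ {s t} → Path 0 s t S → ¬ High s
    -- The vertex `N.b` after `x₀` is high, and it is not close to the start.
    ¬High-start q hs = N.s≁b (heavy (High⇒Heavy hs (Heavy⇒Highʳ {N.a} {N.b} N.a-b-heavy)))
      where module N = AroundNeighbour (around-neighbour q wx₀ x₀∈S) wx₀

    -- Suppose `y` is adjacent to `s` but is not the second vertex, and let `d`, `e` be its path
    -- neighbours. Two of `s`, `d`, `e` form a heavy pair, so `s` or `d` is high. Rotating the path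
    -- at `y` makes `d` a start, and no start is high.
    start-neighbour-unique : ∀ {s t y z} → Path 0 s t S → s ≢ t → Adj G y s → Adj G z s → y ≡ z
    start-neighbour-unique {s} {t} q s≢t ys zs with uncons q s≢t
    ... | uncons-at {second = v₂} sv q′ parts₀ = trans (second ys) (sym (second zs))
      where
      second : ∀ {y} → Adj G y s → y ≡ v₂
      second {y} ys with ∈-resp-↭ parts₀ (start-neighbour∈S q ys)
      ... | here y≡s = ⊥-elim (Adj⇒≢ ys y≡s)
      ... | there y∈S′ with split q′ y∈S′
      ...   | inj₁ y≡v₂ = y≡v₂
      ...   | inj₂ (split-at {D} {pred = d} q₁ l q₂ parts₁)
        with uncons q₂ (λ { refl → ¬Close-ends q (edge (Adj-sym ys)) })
      ...     | uncons-at {E} {e} ye q₃ parts₂ = contra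
        where
        parts′ : S ↭ s ∷ D ++ y ∷ E
        parts′ = ↭-trans parts₀ (prep s (↭-trans parts₁ (++⁺ˡ D parts₂)))

        rotated : Path 0 d t S
        rotated = rev q₁ —⟨ edge {0} (Adj-sym sv) ⟩ ⟨ s ⟩ —⟨ edge {0} (Adj-sym ys) ⟩
                  ⟨ y ⟩ —⟨ edge {0} ye ⟩ q₃
          ▷ ↭-trans (↭-solve 4 (λ D s y E → D ⊕ s ⊕ y ⊕ E ⊜ s ⊕ D ⊕ y ⊕ E) ↭-refl
              D [ s ] [ y ] E) (↭-sym parts′)

        unique′ : Unique (s ∷ D ++ y ∷ E)
        unique′ = Unique-resp-↭ parts′ uS

        s≢ : ∀ {v} → v ∈ D ++ y ∷ E → s ≢ v
        s≢ v∈ = Unique⇒disjoint [ s ] unique′ (here refl) v∈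

        d≢e : d ≢ e
        d≢e = Unique⇒disjoint (s ∷ D) unique′ (there (end∈ q₁)) (there (start∈ q₃))

        contra : y ≡ v₂
        contra with claw-heavy ys (Adj-sym (Step₀ l)) ye (s≢ (∈-++⁺ˡ (end∈ q₁)))
          (s≢ (∈-++⁺ʳ D (there (start∈ q₃)))) d≢e
        ... | inj₁ h        = ⊥-elim (¬High-start q (Heavy⇒Highˡ {s} {d} h))
        ... | inj₂ (inj₁ h) = ⊥-elim (¬High-start q (Heavy⇒Highˡ {s} {e} h))
        ... | inj₂ (inj₂ h) = ⊥-elim (¬High-start rotated (Heavy⇒Highˡ {d} {e} h))

    -- The predecessors of `x₀` and of `x` are both high, hence form a heavy pair. Linking them and
    -- reversing the part from `x₀` up to the predecessor of `x` makes room for `w` between `x₀` and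
    -- `x`.
    no-later-neighbour : ∀ {s t x} → Path 0 s t S → (r : Around s t x₀) → Adj G w x →
      x ∉ Around.B r
    no-later-neighbour {s} {t} {x} q r wx x∈B with split (Around.after r) x∈B
    ... | inj₁ refl = N.w≁b (edge wx)
      where module N = AroundNeighbour r wx₀
    ... | inj₂ (split-at {D} {pred = d} q₁ l q₂ parts₁)
      with uncons q₂ (λ { refl → ¬Close-w-start (rev q) (edge wx) })
    ...   | uncons-at {E} xe q₃ parts₂ = no-extension w∉S
      (N.before —⟨ heavy {0} (High⇒Heavy ha hd) ⟩ rev q₁ —⟨ edge {0} (Adj-sym N.xb) ⟩ ⟨ x₀ ⟩
        —⟨ edge {0} (Adj-sym wx₀) ⟩ ⟨ w ⟩ —⟨ edge {0} wx ⟩ ⟨ x ⟩ —⟨ edge {0} xe ⟩ q₃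
        ▷ ↭-trans (↭-solve 6 (λ A D x₀ w x E → A ⊕ D ⊕ x₀ ⊕ w ⊕ x ⊕ E ⊜
                      w ⊕ (A ⊕ x₀ ⊕ D) ⊕ x ⊕ E) ↭-refl N.A D [ x₀ ] [ w ] [ x ] E)
            (prep w (↭-sym parts′)))
      where
      module N = AroundNeighbour r wx₀
      parts′ : S ↭ (N.A ++ x₀ ∷ D) ++ x ∷ E
      parts′ = ↭-trans N.parts (↭-trans
        (++⁺ˡ N.A (prep x₀ (↭-trans parts₁ (++⁺ˡ D parts₂))))
        (↭-reflexive (sym (++-assoc N.A (x₀ ∷ D) (x ∷ E)))))
      r′ : Around s t x
      r′ = around-at (N.before —⟨ edge {0} N.ax ⟩ ⟨ x₀ ⟩ —⟨ edge {0} N.xb ⟩ q₁) (Step₀ l) xe q₃ parts′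
      ha : High N.a
      ha = Heavy⇒Highˡ {N.a} {N.b} N.a-b-heavy
      hd : High d
      hd = Heavy⇒Highˡ {d} (AroundNeighbour.a-b-heavy r′ wx)

    w-neighbour-unique : ∀ {x} → Adj G w x → x ∈ S → x ≡ x₀
    w-neighbour-unique wx x∈S with ∈-++⁻ A (∈-resp-↭ parts x∈S)
    ... | inj₁ x∈A         = ⊥-elim (no-later-neighbour (rev p) (flip r₀) wx x∈A)
    ... | inj₂ (here x≡x₀) = x≡x₀
    ... | inj₂ (there x∈B) = ⊥-elim (no-later-neighbour p r₀ wx x∈B)

    High-∉N[w]⇒hits-ends : ∀ {v} → High v → ¬ Adj G v w → Adj G v s ⊎ Adj G v t
    High-∉N[w]⇒hits-ends {v} hv ¬vw with Adj? G v s | Adj? G v t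
    ... | yes vs | _      = inj₁ vs
    ... | no _   | yes vt = inj₂ vt
    ... | no ¬vs | no ¬vt = ⊥-elim (High⇒hits-T hv
      λ { zero → ¬vw ; (suc zero) → ¬vs ; (suc (suc zero)) → ¬vt })

    pred-neighbour∉N[w] : ∀ {q} → Adj G a q → q ≢ x₀ → ¬ Adj G q w
    pred-neighbour∉N[w] {q} aq q≢x₀ qw with q ∈? S
    ... | yes q∈S = q≢x₀ (w-neighbour-unique (Adj-sym qw) q∈S)
    -- Off the path, both `q` and `w` could be inserted between `a` and `x₀`.
    ... | no  q∉S = <⇒≱ (n<1+n _) (≤-trans (n≤1+n _) (longest
      (before —⟨ edge {0} aq ⟩ ⟨ q ⟩ —⟨ edge {0} qw ⟩ ⟨ w ⟩ —⟨ edge {0} wx₀ ⟩ ⟨ x₀ ⟩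
        —⟨ edge {0} xb ⟩ after
        ▷ ↭-trans (↭-solve 5 (λ A q w x B → A ⊕ q ⊕ w ⊕ x ⊕ B ⊜ q ⊕ w ⊕ A ⊕ x ⊕ B) ↭-refl
            A [ q ] [ w ] [ x₀ ] B) (prep q (prep w (↭-sym parts))))
      (((Adj⇒≢ qw) ∷ ¬Any⇒All¬ S q∉S) ∷ ∉⇒Unique w∉S uS)))

    -- Pigeonhole: three vertices meet two ends that have one neighbour each.
    ends-hit-twice : ∀ {u v z} → Adj G u s ⊎ Adj G u t → Adj G v s ⊎ Adj G v t →
      Adj G z s ⊎ Adj G z t → u ≢ v → u ≢ z → v ≢ z → ⊥
    ends-hit-twice {u} {v} {z} = go
      where
      S-end : ∀ {u v} → Adj G u s → Adj G v s → u ≡ v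
      S-end = start-neighbour-unique p s≢t
      T-end : ∀ {u v} → Adj G u t → Adj G v t → u ≡ v
      T-end = start-neighbour-unique (rev p) (≢-sym s≢t)
      go : Adj G u s ⊎ Adj G u t → Adj G v s ⊎ Adj G v t →
        Adj G z s ⊎ Adj G z t → u ≢ v → u ≢ z → v ≢ z → ⊥
      go (inj₁ us) (inj₁ vs) _         u≢v _ _ = u≢v (S-end us vs)
      go (inj₁ us) (inj₂ _)  (inj₁ zs) _ u≢z _ = u≢z (S-end us zs)
      go (inj₁ _)  (inj₂ vt) (inj₂ zt) _ _ v≢z = v≢z (T-end vt zt)
      go (inj₂ _)  (inj₁ vs) (inj₁ zs) _ _ v≢z = v≢z (S-end vs zs)
      go (inj₂ ut) (inj₁ _)  (inj₂ zt) _ u≢z _ = u≢z (T-end ut zt)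
      go (inj₂ ut) (inj₂ vt) _         u≢v _ _ = u≢v (T-end ut vt)

    no-third-high : ∀ {q} → Adj G a q → High q → q ≢ x₀ → ⊥
    no-third-high {q} aq hq q≢x₀ = ends-hit-twice
      (High-∉N[w]⇒hits-ends (Heavy⇒Highˡ {a} {b} a-b-heavy) (λ aw → w≁a (edge (Adj-sym aw))))
      (High-∉N[w]⇒hits-ends (Heavy⇒Highʳ {a} {b} a-b-heavy) (λ bw → w≁b (edge (Adj-sym bw))))
      (High-∉N[w]⇒hits-ends hq (pred-neighbour∉N[w] aq q≢x₀))
      -- If `q` were `b`, then `a`, `x₀`, `b` would be a triangle.
      (A≢B a∈A b∈B) (Adj⇒≢ aq) (λ { refl → triangle-free ax xb aq })

    no-path : ⊥
    no-path with heavy-neighbours (Heavy⇒Highˡ {a} {b} a-b-heavy)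
    -- Both members of the heavy pair are high, and at least one differs from `x₀`.
    ... | q , q′ , aq , aq′ , q≢q′ , h with q Fin.≟ x₀
    ...   | no q≢x₀  = no-third-high aq (Heavy⇒Highˡ {q} {q′} h) q≢x₀
    ...   | yes refl = no-third-high aq′ (Heavy⇒Highʳ {q} {q′} h) (≢-sym q≢q′)

-- Graphs with a triangle

module CompleteMultipartite (G : Graph n)
  (connected : Connected G) (claw : ClawO-1Heavy G) (Z₁-free : Z1Free G) where

  open Paths G
  open Degrees G

  record Triangle (x y z : V) : Set where
    constructor triangle
    field
      xy : Adj G x y
      yz : Adj G y z
      xz : Adj G x z

  rotate : ∀ {x y z} → Triangle x y z → Triangle y z x
  rotate (triangle xy yz xz) = triangle yz (Adj-sym xz) (Adj-sym xy)

  -- Otherwise `v` is the pendant vertex of an induced `Z₁`.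
  second-neighbour : ∀ {x y z v} → Triangle x y z → Adj G v x → Adj G v y ⊎ Adj G v z
  second-neighbour {x} {y} {z} {v} (triangle xy yz xz) vx with Adj? G v y | Adj? G v z
  ... | yes vy | _      = inj₁ vy
  ... | no _   | yes vz = inj₂ vz
  ... | no ¬vy | no ¬vz = ⊥-elim (Z₁-free x y z v
    ( xy , xz , yz , Adj-sym vx , (λ yv → ¬vy (Adj-sym yv)) , (λ zv → ¬vz (Adj-sym zv))
    , (λ { refl → ¬vz yz }) , (λ { refl → ¬vy (Adj-sym yz) })))

  TwoNeighbours : V → V → V → V → Set
  TwoNeighbours x y z v =
    (Adj G v x × Adj G v y) ⊎ (Adj G v y × Adj G v z) ⊎ (Adj G v z × Adj G v x)

  two-neighbours : ∀ {x y z v} → Triangle x y z → Adj G v x ⊎ Adj G v y ⊎ Adj G v z →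
    TwoNeighbours x y z v
  two-neighbours T (inj₁ vx) with second-neighbour T vx
  ... | inj₁ vy = inj₁ (vx , vy)
  ... | inj₂ vz = inj₂ (inj₂ (vz , vx))
  two-neighbours T (inj₂ (inj₁ vy)) with second-neighbour (rotate T) vy
  ... | inj₁ vz = inj₂ (inj₁ (vy , vz))
  ... | inj₂ vx = inj₁ (vx , vy)
  two-neighbours T (inj₂ (inj₂ vz)) with second-neighbour (rotate (rotate T)) vz
  ... | inj₁ vx = inj₂ (inj₂ (vz , vx))
  ... | inj₂ vy = inj₂ (inj₁ (vy , vz))

  -- `u` forms a triangle with two of the corners, so its neighbour `v` is adjacent to one of them,
  -- and then to a second corner.
  propagate : ∀ {x y z u v} → Triangle x y z → TwoNeighbours x y z u → Adj G v u →
    TwoNeighbours x y z v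
  propagate T@(triangle xy yz xz) (inj₁ (ux , uy)) vu
    with second-neighbour (triangle ux xy uy) vu
  ... | inj₁ vx = two-neighbours T (inj₁ vx)
  ... | inj₂ vy = two-neighbours T (inj₂ (inj₁ vy))
  propagate T@(triangle xy yz xz) (inj₂ (inj₁ (uy , uz))) vu
    with second-neighbour (triangle uy yz uz) vu
  ... | inj₁ vy = two-neighbours T (inj₂ (inj₁ vy))
  ... | inj₂ vz = two-neighbours T (inj₂ (inj₂ vz))
  propagate T@(triangle xy yz xz) (inj₂ (inj₂ (uz , ux))) vu
    with second-neighbour (triangle uz (Adj-sym xz) ux) vu
  ... | inj₁ vz = two-neighbours T (inj₂ (inj₂ vz))
  ... | inj₂ vx = two-neighbours T (inj₁ vx)

  -- The property spreads along a path from the corner `x`, which is itself adjacent to `y` and `z`.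
  dominates : ∀ {x y z} → Triangle x y z → ∀ v → TwoNeighbours x y z v
  dominates {x} T@(triangle xy yz xz) v = go (inj₂ (inj₁ (xy , xz))) (connected x v)
    where
    go : ∀ {u} → TwoNeighbours _ _ _ u → PathFrom G u v → TwoNeighbours _ _ _ v
    go two (here _)   = two
    go two (step e p) = go (propagate T two (Adj-sym e)) p

  switch : ∀ {u v p q} → Triangle u p q → Adj G u v → ∃[ r ] Triangle u v r
  switch T@(triangle up pq uq) uv with second-neighbour T (Adj-sym uv)
  ... | inj₁ vp = _ , triangle uv vp up
  ... | inj₂ vq = _ , triangle uv vq uq

  -- `u` lies in a triangle with two of the corners, and its neighbour `v` is adjacent to one of
  -- these.
  edge-in-triangle : ∀ {x y z u v} → Triangle x y z → Adj G u v → ∃[ r ] Triangle u v r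
  edge-in-triangle {u = u} T@(triangle xy yz xz) uv with dominates T u
  ... | inj₁ (ux , uy)        = switch (triangle ux xy uy) uv
  ... | inj₂ (inj₁ (uy , uz)) = switch (triangle uy yz uz) uv
  ... | inj₂ (inj₂ (uz , ux)) = switch (triangle uz (Adj-sym xz) ux) uv

  module WithTriangle {x y z : V} (T : Triangle x y z) where

    -- Two neighbours in a triangle on the edge include an end of the edge. This says that
    -- non-adjacency is transitive, that is, the graph is complete multipartite.
    edge-dominates : ∀ {u c} → Adj G u c → ∀ v → Adj G v u ⊎ Adj G v c
    edge-dominates uc v with edge-in-triangle T uc
    ... | _ , T′ with dominates T′ v
    ...   | inj₁ (vu , _)        = inj₁ vu
    ...   | inj₂ (inj₁ (vc , _)) = inj₂ vc
    ...   | inj₂ (inj₂ (_ , vu)) = inj₁ vu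

    non-adjacent⇒⊆ : ∀ {u v c} → ¬ Adj G v u → Adj G u c → Adj G v c
    non-adjacent⇒⊆ {v = v} ¬vu uc with edge-dominates uc v
    ... | inj₁ vu = ⊥-elim (¬vu vu)
    ... | inj₂ vc = vc

    non-adjacent⇒deg≡ : ∀ {u v} → ¬ Adj G u v → deg G u ≡ deg G v
    non-adjacent⇒deg≡ ¬uv = cong length (filter-≐ _ _
      ( (λ uc → from (non-adjacent⇒⊆ (¬uv ∘ Adj-sym) (to uc)))
      , (λ vc → from (non-adjacent⇒⊆ ¬uv (to vc)))) (allFin n))
      where
      to : ∀ {b} → Bool.T b → b ≡ true
      to = Equivalence.to T-≡
      from : ∀ {b} → b ≡ true → Bool.T b
      from = Equivalence.from T-≡

    start-neighbour : ∀ {u v} → u ≢ v → PathFrom G u v → ∃[ c ] Adj G u c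
    start-neighbour u≢v (here _)   = ⊥-elim (u≢v refl)
    start-neighbour u≢v (step e _) = _ , e

    -- A third vertex `t` of the same part gives a claw whose leaves have equal degrees, so any
    -- heavy pair makes `u`, `v` heavy. Without one, `u` is adjacent to all but `u` and `v`, and its
    -- degree is at least 1.
    non-adjacent⇒Heavy : ∀ {u v} → u ≢ v → ¬ Adj G u v → Heavy u v
    non-adjacent⇒Heavy {u} {v} u≢v ¬uv with start-neighbour u≢v (connected u v)
      | Fin.any? (λ t → ¬? (Adj? G u t) ×-dec ¬? (t Fin.≟ u) ×-dec ¬? (t Fin.≟ v))
    ... | c , uc | yes (t , ¬ut , t≢u , t≢v) = all-equal (claw c u v t
      ( Adj-sym uc , Adj-sym vc , Adj-sym (non-adjacent⇒⊆ (¬ut ∘ Adj-sym) uc)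
      , ¬uv , ¬ut , ¬vt , u≢v , ≢-sym t≢u , ≢-sym t≢v))
      where
      vc : Adj G v c
      vc = non-adjacent⇒⊆ (¬uv ∘ Adj-sym) uc
      ¬vt : ¬ Adj G v t
      ¬vt vt = ¬ut (non-adjacent⇒⊆ ¬uv vt)
      u≡v : deg G u ≡ deg G v
      u≡v = non-adjacent⇒deg≡ ¬uv
      u≡t : deg G u ≡ deg G t
      u≡t = non-adjacent⇒deg≡ ¬ut
      all-equal : (Heavy u v) ⊎ (Heavy u t) ⊎ (Heavy v t) → Heavy u v
      all-equal (inj₁ h)        = h
      all-equal (inj₂ (inj₁ h)) =
        ≤-trans h (≤-reflexive (cong (deg G u +_) (trans (sym u≡t) u≡v)))
      all-equal (inj₂ (inj₂ h)) =
        ≤-trans h (≤-reflexive (cong₂ _+_ (sym u≡v) (trans (sym u≡t) u≡v)))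
    ... | c , uc | no ∄third = begin
      n ∸ 1                 ≤⟨ ∸-monoˡ-≤ 1 (cover⇒≤length (u ∷ v ∷ neighbours u) cover) ⟩
      1 + deg G u           ≤⟨ +-monoˡ-≤ (deg G u) (∈⇒1≤length (∈-neighbours⁺ uc)) ⟩
      deg G u + deg G u     ≡⟨ cong (deg G u +_) (non-adjacent⇒deg≡ ¬uv) ⟩
      deg G u + deg G v     ∎
      where
      open ≤-Reasoning
      ∈⇒1≤length : ∀ {a : V} {L} → a ∈ L → 1 ≤ length L
      ∈⇒1≤length {L = _ ∷ _} _ = s≤s z≤n
      cover : ∀ t → t ∈ u ∷ v ∷ neighbours u
      cover t with t Fin.≟ u | t Fin.≟ v | Adj? G u t
      ... | yes t≡u | _       | _      = here t≡u
      ... | no _    | yes t≡v | _      = there (here t≡v)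
      ... | no _    | no _    | yes ut = there (there (∈-neighbours⁺ ut))
      ... | no t≢u  | no t≢v  | no ¬ut = ⊥-elim (∄third (t , ¬ut , t≢u , t≢v))

    close : ∀ {u v} → u ≢ v → Step 1 u v
    close {u} {v} u≢v with Adj? G u v
    ... | yes uv = edge uv
    ... | no ¬uv = heavy (non-adjacent⇒Heavy u≢v ¬uv)

    path-through : ∀ a L → Unique (a ∷ L) → ∃[ k ] ∃[ t ] Path k a t (a ∷ L)
    path-through a []      u                 = 0 , a , ⟨ a ⟩
    path-through a (b ∷ L) ((a≢b ∷ _) ∷ u) with path-through b L u
    ... | _ , t , p = _ , t , (⟨ a ⟩ —⟨ close a≢b ⟩ p)

-- Refuting the absence of a Hamiltonian path

module Refute {m : ℕ} (G : Graph (suc m)) (connected : Connected G)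
  (claw : ClawO-1Heavy G) (Z₁-free : Z1Free G) (none : ¬ HamiltonianPath G) where

  open Paths G

  no-spanning-path : ∀ {s t L} → Unique L → length L ≡ suc m → ¬ Path 0 s t L
  no-spanning-path uL full (path p L↭) = none
    (_ , trans (↭-length L↭) full , route⇒walk p , Unique-resp-↭ (↭-sym L↭) uL)

  -- With a triangle any two vertices are close, so the list of all vertices is a path with heavy
  -- steps. It is trivially longest, and its heavy steps can be removed.
  triangle-free : ∀ {x y z} → Adj G x y → Adj G y z → Adj G x z → ⊥
  triangle-free xy yz xz = remove-gaps (no-spanning-path all-unique all-full) k p
    where
    open CompleteMultipartite G connected claw Z₁-free
    open WithTriangle (triangle xy yz xz)
    all-unique : Unique (allFin (suc m))
    all-unique = allFin⁺ (suc m)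
    all-full : length (allFin (suc m)) ≡ suc m
    all-full = length-tabulate (λ i → i)
    open Longest G (allFin (suc m)) all-unique
      (λ _ uL → ≤-trans (Unique⇒length≤ uL) (≤-reflexive (sym all-full)))
    through = path-through zero _ all-unique
    k = proj₁ through
    p = proj₂ (proj₂ through)

  leave : ∀ {u v} (S : List V) → u ∉ S → v ∈ S → PathFrom G u v →
    ∃[ w ] ∃[ x ] (w ∉ S × x ∈ S × Adj G w x)
  leave S u∉S v∈S (here _) = ⊥-elim (u∉S v∈S)
  leave S u∉S v∈S (step {w = u′} e p) with u′ ∈? S
  ... | yes u′∈S = _ , u′ , u∉S , u′∈S , e
  ... | no  u′∉S = leave S u′∉S v∈S p

  -- Induction on a bound `d` for the number of missing vertices: longer paths are already excluded,
  -- so the path at hand may be treated as longest.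
  no-long-path : ∀ d {k s t S} → suc m ≤ d + length S → Unique S → ¬ Path k s t S
  no-long-path d {k} {s} {S = S} bound uS p = remove-gaps gap-free k p
    where
    longest : ∀ {k s t L} → Path k s t L → Unique L → length L ≤ length S
    longest {L = L} q uL with length L ≤? length S
    ... | yes L≤S = L≤S
    ... | no  L≰S = ⊥-elim (longer d bound)
      where
      longer : ∀ d → suc m ≤ d + length S → ⊥
      longer zero    bound = L≰S (≤-trans (Unique⇒length≤ uL) bound)
      longer (suc d) bound = no-long-path d
        (≤-trans bound (≤-trans (≤-reflexive (sym (+-suc d _))) (+-monoʳ-≤ d (≰⇒> L≰S)))) uL q
    open Longest G S uS longest

    gap-free : ∀ {s t} → ¬ Path 0 s t S
    gap-free q with <-cmp (length S) (suc m)
    ... | tri≈ _ full _ = no-spanning-path uS full q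
    ... | tri> _ _ S>n  = <⇒≱ S>n (Unique⇒length≤ uS)
    ... | tri< S<n _ _ with <length⇒∃∉ S S<n
    ...   | v , v∉S with leave S v∉S (start∈ q) (connected v _)
    ...     | w , x , w∉S , x∈S , wx =
      Contradiction.no-path q (around-neighbour q wx x∈S)
      where open TriangleFree G claw triangle-free S uS longest w w∉S x x∈S wx

  contradiction : ⊥
  contradiction = no-long-path (suc m) (m≤m+n _ _) ([] ∷ []) ⟨ zero ⟩

theorem7 : ∀ {n : ℕ} (G : Graph n) → Connected G → ClawO-1Heavy G → Z1Free G → Traceable G
theorem7 {zero}  G _ _ _ = [] , nil , [] , λ ()
theorem7 {suc m} G connected claw Z₁-free with hamiltonianPath? G
... | yes path = HamiltonianPath⇒Traceable G path
... | no  none = ⊥-elim (Refute.contradiction G connected claw Z₁-free none)
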